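{- Let $\mathit{Exp}$ be the set of conditional expressions over a set $A$ of symbols, $\mathit{Exp}_\bot$ the corresponding flat domain, and let $norm_2:\mathit{Exp}_\bot\to\mathit{Exp}_\bot$ be a continuous (equivalently, monotone) function satisfying, for all $a\in A$ and all $u,v,w,y,z\in\mathit{Exp}$, $$norm_2(At(a))=At(a),$$ $$norm_2(\mathit{If}(At(a),y,z))=\mathit{If}(At(a),norm_2(y),norm_2(z)),$$ $$norm_2(\mathit{If}(\mathit{If}(u,v,w),y,z))=norm_2\bigl(\mathit{If}(u,\,norm_2(\mathit{If}(v,y,z)),\,norm_2(\mathit{If}(w,y,z)))\bigr).$$ Then $ISN(norm_2(x))$ holds for every $x\in\mathit{Exp}$; that is, $norm_2$ is total on defined expressions and its result is always in normal form.
   Context: Fix a set $A$ of symbols. The set $\mathit{Exp}$ of conditional expressions is the inductive type freely generated by the constructors $At(a)$ for $a\in A$ and $\mathit{If}(x,y,z)$ for $x,y,z\in\mathit{Exp}$. The flat domain $\mathit{Exp}_\bot=\mathit{Exp}\cup\{\bot\}$ adds one undefined element $\bot$, ordered by $p\sqsubseteq q$ iff $p=\bot$ or $p=q$; $\mathit{If}$ is extended strictly to $\mathit{Exp}_\bot$, so $\mathit{If}(x,y,z)=\bot$ if any of $x,y,z$ is $\bot$. The predicate $ISN$ ("is in normal form") on $\mathit{Exp}_\bot$ is defined recursively, for $a\in A$ and $u,v,w,y,z\in\mathit{Exp}$, by $$ISN(\bot)\iff\textit{false},\qquad ISN(At(a))\iff\textit{true},$$ $$ISN(\mathit{If}(At(a),y,z))\iff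 ISN(y)\wedge ISN(z),\qquad ISN(\mathit{If}(\mathit{If}(u,v,w),y,z))\iff\textit{false}.$$ -}

module Defs where

open import Level using (Level)
open import Data.Empty using (⊥)
open import Data.Maybe.Base using (Maybe; just; nothing)
open import Data.Product.Base using (_×_)
open import Data.Sum.Base using (_⊎_)
open import Data.Unit.Base using (⊤)
open import Relation.Binary.Core using (_Preserves_⟶_)
open import Relation.Binary.PropositionalEquality.Core using (_≡_)

private
  variable
    ℓ : Level
    A : Set ℓ

data Exp (A : Set ℓ) : Set ℓ where
  At : A → Exp A
  If : Exp A → Exp A → Exp A → Exp A

-- The flat domain Exp ∪ {⊥}: the undefined element is `nothing`.
Exp⊥ : Set ℓ → Set ℓ
Exp⊥ A = Maybe (Exp A)

infix 4 _⊑_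

_⊑_ : {A : Set ℓ} → Exp⊥ A → Exp⊥ A → Set ℓ
p ⊑ q = p ≡ nothing ⊎ p ≡ q

If⊥ : Exp⊥ A → Exp⊥ A → Exp⊥ A → Exp⊥ A
If⊥ (just x) (just y) (just z) = just (If x y z)
If⊥ _        _        _        = nothing

ISN : Exp⊥ A → Set
ISN nothing                       = ⊥
ISN (just (At a))                 = ⊤
ISN (just (If (At a) y z))        = ISN (just y) × ISN (just z)
ISN (just (If (If u v w) y z))    = ⊥

-- On a flat domain every directed set has at most one defined element, so
-- Scott continuity amounts to monotonicity.
Monotone : {A : Set ℓ} → (Exp⊥ A → Exp⊥ A) → Set ℓ
Monotone f = f Preserves _⊑_ ⟶ _⊑_

{-# OPTIONS --safe #-}
-- Induct on x.  In the case If(u, y, z), a further structural induction on the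
-- test u, for arbitrary y and z whose normal forms exist, suffices: in the
-- nested call the branches are replaced by normal forms p and q, and norm₂ is
-- defined and normal on these because every normal form is mapped to one.
module Submission where

open import Data.Maybe.Base using (just; nothing)
open import Data.Product.Base using (_,_)
open import Data.Unit.Base using (tt)
open import Relation.Binary.PropositionalEquality using (_≡_; sym; subst)
open import Defs

-- `ISN` is empty at `nothing`, so normality of `p` and `q` forces both to be defined, and `If⊥`
-- then computes. `P` is kept general to serve both `ISN` and `ISN` after a further `norm`.
If⊥-elim : ∀ {ℓ} {A : Set ℓ} (P : Exp⊥ A → Set) (u : Exp A) (p q : Exp⊥ A) →
  (∀ y z → ISN (just y) → ISN (just z) → P (just (If u y z))) →
  ISN p → ISN q → P (If⊥ (just u) p q)
If⊥-elim P u (just y) (just z) h hy hz = h y z hy hz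
If⊥-elim P u nothing  _        h () _
If⊥-elim P u (just _) nothing  h _  ()

module _ {ℓ} {A : Set ℓ} (norm : Exp⊥ A → Exp⊥ A)
  (norm-At : ∀ a → norm (just (At a)) ≡ just (At a))
  (norm-If-At : ∀ a y z →
    norm (just (If (At a) y z))
      ≡ If⊥ (just (At a)) (norm (just y)) (norm (just z)))
  (norm-If-If : ∀ u v w y z →
    norm (just (If (If u v w) y z))
      ≡ norm (If⊥ (just u) (norm (just (If v y z))) (norm (just (If w y z)))))
  where

  ISN-norm-At : ∀ a → ISN (norm (just (At a)))
  ISN-norm-At a = subst ISN (sym (norm-At a)) tt

  ISN-norm-If-At : ∀ a y z → ISN (norm (just y)) → ISN (norm (just z)) →
    ISN (norm (just (If (At a) y z)))
  ISN-norm-If-At a y z hy hz = subst ISN (sym (norm-If-At a y z))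
    (If⊥-elim ISN (At a) (norm (just y)) (norm (just z))
      (λ _ _ → _,_) hy hz)

  -- Every test in a normal form is an atom, so the nested equation for `norm` never comes up.
  ISN⇒ISN-norm : ∀ x → ISN (just x) → ISN (norm (just x))
  ISN⇒ISN-norm (At a)             _         = ISN-norm-At a
  ISN⇒ISN-norm (If (At a) y z)    (hy , hz) =
    ISN-norm-If-At a y z (ISN⇒ISN-norm y hy) (ISN⇒ISN-norm z hz)
  ISN⇒ISN-norm (If (If _ _ _) _ _) ()

  ISN-norm-If : ∀ u y z → ISN (norm (just y)) → ISN (norm (just z)) →
    ISN (norm (just (If u y z)))
  ISN-norm-If (At a)     y z hy hz = ISN-norm-If-At a y z hy hz
  ISN-norm-If (If u v w) y z hy hz = subst ISN (sym (norm-If-If u v w y z))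
    (If⊥-elim (λ e → ISN (norm e)) u
      (norm (just (If v y z))) (norm (just (If w y z)))
      -- `p` and `q` stand for the values of the inner calls and may be large; the recursion is
      -- sound because the test shrinks from `If u v w` to `u`, just as it shrinks to `v` and `w` in
      -- the inner calls.
      (λ p q hp hq → ISN-norm-If u p q (ISN⇒ISN-norm p hp) (ISN⇒ISN-norm q hq))
      (ISN-norm-If v y z hy hz) (ISN-norm-If w y z hy hz))

  ISN-norm : ∀ x → ISN (norm (just x))
  ISN-norm (At a)     = ISN-norm-At a
  ISN-norm (If x y z) = ISN-norm-If x y z (ISN-norm y) (ISN-norm z)

mainTheorem4 : ∀ {ℓ} (A : Set ℓ) (norm₂ : Exp⊥ A → Exp⊥ A) →
    Monotone norm₂ →
    (∀ a → norm₂ (just (At a)) ≡ just (At a)) →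
    (∀ a y z →
    norm₂ (just (If (At a) y z))
    ≡ If⊥ (just (At a)) (norm₂ (just y)) (norm₂ (just z))) →
    (∀ u v w y z →
    norm₂ (just (If (If u v w) y z))
    ≡ norm₂ (If⊥ (just u) (norm₂ (just (If v y z))) (norm₂ (just (If w y z))))) →
    ∀ (x : Exp A) → ISN (norm₂ (just x))
mainTheorem4 A norm₂ _ = ISN-norm norm₂
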